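{- If $G$ is a $4$-$\chi_i$-lower-game-vertex-critical graph, then $\delta(G) \geq 3$.
   Context: All graphs are simple, undirected and finite; $\delta(G)$ is the minimum vertex degree of $G$. The indicated coloring game on a graph $G$ with color set $\{1,\ldots,k\}$ is played by Ann and Ben. In every round Ann selects a previously uncolored vertex and Ben colors it with any color from $\{1,\ldots,k\}$ that has not been used on its neighbors. Ann's goal is a proper coloring of the whole graph; Ben wins if at some point there is an uncolored vertex having all colors $1,\ldots,k$ in its neighborhood. The indicated chromatic number $\chi_i(G)$ is the minimum $k$ for which Ann has a winning strategy on $G$, no matter how Ben plays. For $x\in V(G)$, $G-x$ is the graph obtained from $G$ by deleting $x$ and all edges incident with $x$. A graph $G$ is $k$-$\chi_i$-lower-game-vertex-critical if $\chi_i(G)=k$ and $\chi_i(G-x)<\chi_i(G)$ for every $x\in V(G)$. -}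

module Defs where

open import Data.Fin.Base using (Fin; punchIn)
open import Data.List.Base using (allFin; filter; length; map)
open import Data.List.Extrema.Nat using (min)
open import Data.Maybe.Base using (Maybe; just; nothing)
open import Data.Nat.Base using (ℕ; suc; pred; _≤_; _<_)
open import Data.Product.Base using (∃-syntax; _×_)
open import Data.Vec.Base using (Vec; lookup; replicate; _[_]≔_)
open import Function.Base using (_∘_)
open import Level using (0ℓ)
open import Relation.Binary.Core using (Rel)
open import Relation.Binary.Definitions using (Decidable; Irreflexive; Symmetric)
open import Relation.Binary.PropositionalEquality.Core using (_≡_; _≢_; cong)
open import Relation.Nullary.Negation.Core using (¬_)

record Graph (n : ℕ) : Set₁ where
  infix 4 _~_ _~?_
  field
    _~_      : Rel (Fin n) 0ℓ
    _~?_     : Decidable _~_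
    ~-sym    : Symmetric _~_
    ~-irrefl : Irreflexive _≡_ _~_

  degree : Fin n → ℕ
  degree v = length (filter (v ~?_) (allFin n))

  -- Every degree is less than n, so the default value n of the minimum is
  -- attained only when there are no vertices (and then δ is 0).
  δ : ℕ
  δ = min n (map degree (allFin n))

open Graph using (δ) public

-- The vertices of G - x are renumbered along the order-preserving bijection
-- punchIn x between Fin n and Fin (suc n) without x.
infixl 6 _-_
_-_ : ∀ {n} → Graph n → Fin n → Graph (pred n)
_-_ {suc n} G x = record
  { _~_      = λ u v → punchIn x u ~ punchIn x v
  ; _~?_     = λ u v → punchIn x u ~? punchIn x v
  ; ~-sym    = ~-sym
  ; ~-irrefl = ~-irrefl ∘ cong (punchIn x)
  }
  where open Graph G

-- Partial colourings with k colours; nothing marks an uncoloured vertex.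
Position : ℕ → ℕ → Set
Position n k = Vec (Maybe (Fin k)) n

module _ {n : ℕ} (G : Graph n) {k : ℕ} where
  open Graph G using (_~_)

  Uncoloured : Position n k → Fin n → Set
  Uncoloured c v = lookup c v ≡ nothing

  Legal : Position n k → Fin n → Fin k → Set
  Legal c v a = ∀ u → v ~ u → lookup c u ≢ just a

  BenWins : Position n k → Set
  BenWins c = ∃[ v ] Uncoloured c v × (∀ a → ∃[ u ] v ~ u × lookup c u ≡ just a)

  -- Winning strategies for Ann from position c, as trees: she names the next
  -- vertex and has a continuation for each of Ben's legal replies.  Excluding
  -- BenWins in pick prevents her from winning vacuously when Ben has no reply.
  data AnnWins (c : Position n k) : Set where
    done : (∀ v → ∃[ a ] lookup c v ≡ just a) → AnnWins c
    pick : ¬ BenWins c →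
           (v : Fin n) → Uncoloured c v →
           (∀ a → Legal c v a → AnnWins (c [ v ]≔ just a)) →
           AnnWins c

AnnWinsWith : ∀ {n} → Graph n → ℕ → Set
AnnWinsWith {n} G k = AnnWins G {k} (replicate n nothing)

-- χᵢ[ G ]≡ k states that the indicated chromatic number of G is k.
infix 4 χᵢ[_]≡_
χᵢ[_]≡_ : ∀ {n} → Graph n → ℕ → Set
χᵢ[ G ]≡ k = AnnWinsWith G k × (∀ j → AnnWinsWith G j → k ≤ j)

LowerGameVertexCritical : ∀ {n} → ℕ → Graph n → Set
LowerGameVertexCritical k G =
  χᵢ[ G ]≡ k × (∀ x → ∃[ j ] χᵢ[ G - x ]≡ j × j < k)

{-# OPTIONS --safe #-}

-- A vertex x of degree at most 2 never sees three colours, so Ann wins on G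
-- with 3 colours as soon as she wins on G - x with 3 colours: she plays G - x
-- first and x last.  If χᵢ(G - x) = 3 this contradicts χᵢ(G) = 4.  If
-- χᵢ(G - x) ≤ 2 then G - x is bipartite, and Ann wins on bipartite graphs with
-- any number k ≥ 2 of colours: she keeps a proper 2-colouring f such that f u
-- is still legal at every uncoloured vertex u.
module Submission where

open import Defs
open import Data.Fin.Base using (Fin; zero; suc; inject≤; opposite; punchIn; punchOut)
open import Data.Fin.Properties
  using (_≟_; any?; ¬∀⟶∃¬; injective⇒≤; inject≤-injective;
         punchIn-injective; punchIn-punchOut; punchInᵢ≢i)
open import Data.List.Base using (allFin)
open import Data.List.Extrema.Nat using (v≤min⁺)
open import Data.List.Membership.Propositional using (_∈_)
open import Data.List.Membership.Propositional.Properties using (∈-allFin; ∈-filter⁺)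
open import Data.List.Membership.Setoid.Properties using (index-injective)
open import Data.List.Properties using (length-filter; length-tabulate)
open import Data.List.Relation.Unary.All using (universal)
open import Data.List.Relation.Unary.All.Properties using (map⁺)
open import Data.List.Relation.Unary.Any using (index)
open import Data.Maybe.Base using (just; nothing; is-nothing)
open import Data.Maybe.Properties using (just-injective; ≡-dec)
open import Data.Nat.Base using (ℕ; zero; suc; _≤_; _<_; _≥_; s≤s; s≤s⁻¹)
open import Data.Nat.Induction using (<-wellFounded)
open import Data.Nat.Properties
  using (≤-refl; ≤-reflexive; ≤-trans; <⇒≱; ≰⇒>; m≤n⇒m<n∨m≡n; n≤1+n)
  renaming (_≤?_ to _≤ℕ?_)
open import Data.Product.Base using (∃-syntax; _×_; _,_; proj₁; proj₂)
open import Data.Sum.Base using (_⊎_; inj₁; inj₂)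
open import Data.Vec.Base using (Vec; _∷_; lookup; replicate; countᵇ; _[_]≔_)
open import Data.Vec.Properties using (lookup∘update; lookup∘update′; lookup-replicate)
open import Function.Base using (id; _∘_; case_of_)
open import Induction.WellFounded using (Acc; acc)
open import Relation.Binary.PropositionalEquality
  using (_≡_; _≢_; refl; sym; trans; cong; subst; setoid)
open import Relation.Nullary using (¬_; Dec; yes; no; contradiction; _×-dec_)

-- Updating positions

lookup-update : ∀ {A : Set} {n} (xs : Vec A n) (i : Fin n) {x y} j →
                lookup (xs [ i ]≔ x) j ≡ y →
                (j ≡ i × x ≡ y) ⊎ (j ≢ i × lookup xs j ≡ y)
lookup-update xs i {x} j eq with j ≟ i
... | yes refl = inj₁ (refl , trans (sym (lookup∘update i xs x)) eq)
... | no  j≢i  = inj₂ (j≢i , trans (sym (lookup∘update′ j≢i xs x)) eq)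

-- The measure on which Ann's strategy for bipartite graphs recurses: each move lowers it.
#uncoloured : ∀ {n k} → Position n k → ℕ
#uncoloured = countᵇ is-nothing

#uncoloured-update : ∀ {n k} (c : Position n k) v {a} → lookup c v ≡ nothing →
                     #uncoloured (c [ v ]≔ just a) < #uncoloured c
#uncoloured-update (nothing ∷ c) zero    refl = ≤-refl
#uncoloured-update (nothing ∷ c) (suc v) eq   = s≤s (#uncoloured-update c v eq)
#uncoloured-update (just _  ∷ c) (suc v) eq   = #uncoloured-update c v eq

-- The game on a fixed graph

module _ {n : ℕ} (G : Graph n) {k : ℕ} where
  open Graph G

  Uncoloured? : (c : Position n k) → ∀ v → Dec (Uncoloured G c v)
  Uncoloured? c v = ≡-dec _≟_ (lookup c v) nothing

  Sees : Position n k → Fin n → Fin k → Set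
  Sees c v a = ∃[ u ] v ~ u × lookup c u ≡ just a

  Sees? : ∀ c v a → Dec (Sees c v a)
  Sees? c v a = any? (λ u → (v ~? u) ×-dec ≡-dec _≟_ (lookup c u) (just a))

  ¬Sees⇒Legal : ∀ c {v a} → ¬ Sees c v a → Legal G c v a
  ¬Sees⇒Legal c ¬sees u v~u eq = ¬sees (u , v~u , eq)

  not-uncoloured : ∀ (c : Position n k) v → ¬ Uncoloured G c v → ∃[ a ] lookup c v ≡ just a
  not-uncoloured c v ¬unc with lookup c v
  ... | just a  = a , refl
  ... | nothing = contradiction refl ¬unc

  Uncoloured-update : ∀ (c : Position n k) {u a} w → Uncoloured G (c [ u ]≔ just a) w →
                      Uncoloured G c w
  Uncoloured-update c {u} w eq with lookup-update c u w eq
  ... | inj₂ (_ , eq′) = eq′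

  Legal-update : ∀ (c : Position n k) {u a w b} → Legal G c w b → (w ~ u → a ≢ b) →
                 Legal G (c [ u ]≔ just a) w b
  Legal-update c {u} legal a≢b v w~v eq with lookup-update c u v eq
  ... | inj₁ (refl , a≡b) = a≢b w~v (just-injective a≡b)
  ... | inj₂ (_ , eq′)    = legal v w~v eq′

  Proper : Position n k → Set
  Proper c = ∀ u a → lookup c u ≡ just a → Legal G c u a

  Proper-update : ∀ c {v a} → Proper c → Legal G c v a → Proper (c [ v ]≔ just a)
  Proper-update c {v} proper legal u b eq with lookup-update c v u eq
  ... | inj₁ (refl , refl) = Legal-update c legal (λ v~v _ → ~-irrefl refl v~v)
  ... | inj₂ (_ , eq′)     = Legal-update c (proper u b eq′)
    λ { u~v refl → legal u (~-sym u~v) eq′ }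

  -- Follow one branch of the strategy tree. As Ben has not won, the vertex that Ann names misses
  -- some colour; let Ben reply with it. Legal replies keep the position proper, and the leaf is a
  -- total colouring.
  AnnWins⇒colouring : ∀ c → Proper c → AnnWins G c →
                      ∃[ h ] (∀ u v → u ~ v → h u ≢ h v)
  AnnWins⇒colouring c proper (done total) =
    proj₁ ∘ total , λ u v u~v hu≡hv →
      proper u _ (proj₂ (total u)) v u~v (trans (proj₂ (total v)) (cong just (sym hu≡hv)))
  AnnWins⇒colouring c proper (pick ¬ben v unc next) =
    let a , ¬sees = ¬∀⟶∃¬ k (Sees c v) (Sees? c v) (λ all → ¬ben (v , unc , all))
        legal     = ¬Sees⇒Legal c ¬sees
    in AnnWins⇒colouring _ (Proper-update c proper legal) (next a legal)

  -- Models a 2-colouring `f` and the colouring `g` with its two colours exchanged, inside a palette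
  -- of `k` colours. The two fields together make both `f` and `g` proper.
  record Swapped (f g : Fin n → Fin k) : Set where
    field
      crossed  : ∀ u v → u ~ v → f v ≡ g u
      distinct : ∀ u → f u ≢ g u

  swap : ∀ {f g} → Swapped f g → Swapped g f
  swap s = record
    { crossed  = λ u v u~v → sym (crossed v u (~-sym u~v))
    ; distinct = λ u → distinct u ∘ sym
    }
    where open Swapped s

  AllLegal : Position n k → (Fin n → Fin k) → Set
  AllLegal c f = ∀ u → Uncoloured G c u → Legal G c u (f u)

  -- Colouring `u` affects only its neighbours, and `f` takes the value `g u` on all of them, so
  -- `g u` is the only harmful answer. With the roles of `f` and `g` exchanged, the harmful answer
  -- is `f u`.
  AllLegal-update : ∀ {f g} → Swapped f g → ∀ c {u a} → AllLegal c f → a ≢ g u →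
                    AllLegal (c [ u ]≔ just a) f
  AllLegal-update s c {u} legal a≢gu w unc =
    Legal-update c (legal w (Uncoloured-update c w unc)) λ w~u a≡fw →
      a≢gu (trans a≡fw (crossed u w (~-sym w~u)))
    where open Swapped s

  AllLegal⇒¬BenWins : ∀ c {f} → AllLegal c f → ¬ BenWins G c
  AllLegal⇒¬BenWins c {f} legal (v , unc , sees) =
    let u , v~u , eq = sees (f v) in legal v unc u v~u eq

  -- Ann prefers a vertex u that sees g u, since Ben cannot answer g u there.
  -- If there is none, g is as good as f, and she switches to g if Ben answers
  -- g u.
  Swapped⇒AnnWins : ∀ {f g} → Swapped f g → ∀ {c} → Acc _<_ (#uncoloured c) →
                    AllLegal c f → AnnWins G c
  Swapped⇒AnnWins {f} {g} s {c} (acc rec) legal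
    with any? (λ u → Uncoloured? c u ×-dec Sees? c u (g u)) | any? (Uncoloured? c)
  ... | yes (u , unc , v , u~v , eq) | _ =
    pick (AllLegal⇒¬BenWins c legal) u unc λ a a-legal →
      Swapped⇒AnnWins s (rec (#uncoloured-update c u unc))
        (AllLegal-update s c legal λ { refl → a-legal v u~v eq })
  ... | no none | yes (u , unc) =
    pick (AllLegal⇒¬BenWins c legal) u unc reply
    where
    open Swapped s
    reply : ∀ a → Legal G c u a → AnnWins G (c [ u ]≔ just a)
    reply a _ with a ≟ g u
    ... | no a≢gu = Swapped⇒AnnWins s (rec (#uncoloured-update c u unc))
      (AllLegal-update s c legal a≢gu)
    ... | yes refl = Swapped⇒AnnWins (swap s) (rec (#uncoloured-update c u unc))
      (AllLegal-update (swap s) c (λ w unc′ → ¬Sees⇒Legal c λ sees → none (w , unc′ , sees))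
        (distinct u ∘ sym))
  ... | no _ | no none = done λ v → not-uncoloured c v λ unc → none (v , unc)

  -- Choose a neighbour of each colour. A vertex has only one colour, so the choice is injective,
  -- and so are the indices of the chosen vertices in the list of neighbours.
  Sees-all⇒k≤degree : ∀ c v → (∀ a → Sees c v a) → k ≤ degree v
  Sees-all⇒k≤degree c v sees = injective⇒≤ {f = index ∘ member} λ {a} {b} eq →
    just-injective (trans (sym (proj₂ (proj₂ (sees a))))
      (trans (cong (lookup c) (index-injective (setoid _) (member a) (member b) eq))
        (proj₂ (proj₂ (sees b)))))
    where
    member : ∀ a → proj₁ (sees a) ∈ _
    member a = ∈-filter⁺ (v ~?_) (∈-allFin (proj₁ (sees a))) (proj₁ (proj₂ (sees a)))

-- Bipartite graphs with at least two colours

two-colours-swap : ∀ {a b : Fin 2} → a ≢ b → b ≡ opposite a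
two-colours-swap {zero}     {zero}     a≢b = contradiction refl a≢b
two-colours-swap {zero}     {suc zero} _   = refl
two-colours-swap {suc zero} {zero}     _   = refl
two-colours-swap {suc zero} {suc zero} a≢b = contradiction refl a≢b

opposite-distinct : (a : Fin 2) → a ≢ opposite a
opposite-distinct zero       ()
opposite-distinct (suc zero) ()

Legal-initial : ∀ {n k} (G : Graph n) v (a : Fin k) → Legal G (replicate n nothing) v a
Legal-initial G v a u _ eq = case trans (sym (lookup-replicate u nothing)) eq of λ ()

bipartite⇒AnnWinsWith : ∀ {n k} (G : Graph n) (let open Graph G) (h : Fin n → Fin 2) →
                        (∀ u v → u ~ v → h u ≢ h v) → 2 ≤ k → AnnWinsWith G k
bipartite⇒AnnWinsWith G h proper 2≤k =
  Swapped⇒AnnWins G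
    {f = λ u → inject≤ (h u) 2≤k} {g = λ u → inject≤ (opposite (h u)) 2≤k}
    (record
      { crossed  = λ u v u~v → cong (λ a → inject≤ a 2≤k) (two-colours-swap (proper u v u~v))
      ; distinct = λ u → opposite-distinct (h u) ∘ inject≤-injective 2≤k 2≤k _ _
      })
    (<-wellFounded _) (λ u _ → Legal-initial G u _)

-- Extra colours also give Ben extra replies, so the strategy for `j` colours is not reused
-- directly. Only the proper colouring that it yields is kept.
≤2⇒AnnWinsWith : ∀ {n j k} (G : Graph n) → AnnWinsWith G j → j ≤ 2 → 2 ≤ k → AnnWinsWith G k
≤2⇒AnnWinsWith G wins j≤2 2≤k =
  let h , proper = AnnWins⇒colouring G _ (λ u a _ → Legal-initial G u a) wins
  in bipartite⇒AnnWinsWith G (λ u → inject≤ (h u) j≤2)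
       (λ u v u~v → proper u v u~v ∘ inject≤-injective j≤2 j≤2 _ _) 2≤k

-- Reinserting a vertex of small degree

module _ {m : ℕ} (G : Graph (suc m)) (x : Fin (suc m)) {k : ℕ} where
  open Graph G

  data View : Fin (suc m) → Set where
    deleted : View x
    kept    : ∀ v → View (punchIn x v)

  view : ∀ v → View v
  view v with x ≟ v
  ... | yes refl = deleted
  ... | no  x≢v  = subst View (punchIn-punchOut x≢v) (kept (punchOut x≢v))

  -- Links the game on `G` to the game on `G - x` that Ann imitates until only `x` is left.
  record Extends (c : Position m k) (c′ : Position (suc m) k) : Set where
    field
      agrees : ∀ v → lookup c′ (punchIn x v) ≡ lookup c v
      open-x : Uncoloured G c′ x

  Extends-update : ∀ {c c′} v a → Extends c c′ →
                   Extends (c [ v ]≔ just a) (c′ [ punchIn x v ]≔ just a)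
  Extends-update {c} {c′} v a e = record
    { agrees = agrees′
    ; open-x = trans (lookup∘update′ (punchInᵢ≢i x v ∘ sym) c′ _) open-x
    }
    where
    open Extends e
    agrees′ : ∀ w → lookup (c′ [ punchIn x v ]≔ just a) (punchIn x w) ≡ lookup (c [ v ]≔ just a) w
    agrees′ w with w ≟ v
    ... | yes refl = trans (lookup∘update (punchIn x v) c′ _) (sym (lookup∘update v c _))
    ... | no  w≢v  = trans (lookup∘update′ (w≢v ∘ punchIn-injective x w v) c′ _)
      (trans (agrees w) (sym (lookup∘update′ w≢v c _)))

  module _ (degree<k : degree x < k) where

    -- The blocked vertex is not `x`, whose degree is too small. Since `x` is uncoloured, all the
    -- colours seen by another blocked vertex come from `G - x`.
    BenWins-restrict : ∀ {c c′} → Extends c c′ → BenWins G c′ → BenWins (G - x) c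
    BenWins-restrict {c} {c′} e (v , unc , sees) with view v
    ... | deleted = contradiction (Sees-all⇒k≤degree G c′ x sees) (<⇒≱ degree<k)
    ... | kept w  = w , trans (sym (agrees w)) unc , λ a → restrict (sees a)
      where
      open Extends e
      restrict : ∀ {a} → Sees G c′ (punchIn x w) a → Sees (G - x) c w a
      restrict (u , w~u , eq) with view u
      ... | deleted = case trans (sym open-x) eq of λ ()
      ... | kept u′ = u′ , w~u , trans (sym (agrees u′)) eq

    AnnWins-extend : ∀ {c c′} → Extends c c′ → AnnWins (G - x) c → AnnWins G c′
    AnnWins-extend {c} {c′} e (done total) =
      -- A win for Ben here would leave an uncoloured vertex in `G - x`, where every vertex is
      -- coloured.
      pick (λ ben → let v , unc , _ = BenWins-restrict e ben
                    in case trans (sym unc) (proj₂ (total v)) of λ ())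
           x open-x λ a _ → done λ v → coloured a (view v)
      where
      open Extends e
      coloured : ∀ a {v} → View v → ∃[ b ] lookup (c′ [ x ]≔ just a) v ≡ just b
      coloured a deleted  = a , lookup∘update x c′ _
      coloured a (kept v) = proj₁ (total v) ,
        trans (lookup∘update′ (punchInᵢ≢i x v) c′ _) (trans (agrees v) (proj₂ (total v)))
    AnnWins-extend e (pick ¬ben v unc next) =
      pick (¬ben ∘ BenWins-restrict e) (punchIn x v) (trans (agrees v) unc) λ a legal →
        AnnWins-extend (Extends-update v a e)
          -- A reply legal in `G` is legal in `G - x`, where a vertex has no further neighbours.
          (next a λ u v~u eq → legal (punchIn x u) v~u (trans (agrees u) eq))
      where open Extends e

    AnnWinsWith-extend : AnnWinsWith (G - x) k → AnnWinsWith G k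
    AnnWinsWith-extend = AnnWins-extend record
      { agrees = λ v → trans (lookup-replicate (punchIn x v) nothing) (sym (lookup-replicate v nothing))
      ; open-x = lookup-replicate x nothing
      }

-- Minimum degree of critical graphs

degree≤n : ∀ {n} (G : Graph n) v → Graph.degree G v ≤ n
degree≤n {n} G v = ≤-trans (length-filter (Graph._~?_ G v) (allFin n))
  (≤-reflexive (length-tabulate {n = n} id))

critical⇒3≤degree : ∀ {m} (G : Graph (suc m)) → LowerGameVertexCritical 4 G →
                    ∀ x → 3 ≤ Graph.degree G x
critical⇒3≤degree G ((_ , least) , critical) x with 3 ≤ℕ? Graph.degree G x
... | yes 3≤d = 3≤d
... | no  3≰d =
  contradiction (least 3 (AnnWinsWith-extend G x (≰⇒> 3≰d) wins₃)) (<⇒≱ ≤-refl)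
  where
  wins₃ : AnnWinsWith (G - x) 3
  wins₃ with critical x
  ... | j , (wins , _) , j<4 with m≤n⇒m<n∨m≡n (s≤s⁻¹ j<4)
  ...   | inj₁ j<3  = ≤2⇒AnnWinsWith (G - x) wins (s≤s⁻¹ j<3) (n≤1+n 2)
  ...   | inj₂ refl = wins

corollary16 : ∀ (n : ℕ) (G : Graph n) → LowerGameVertexCritical 4 G → δ G ≥ 3
-- On the empty graph Ann wins with 0 colours, so `least` would give `4 ≤ 0`.
corollary16 zero    G ((_ , least) , _) = case least 0 (done λ ()) of λ ()
corollary16 (suc m) G crit =
  -- The default value of the minimum, the number of vertices, must be at least 3 too; it bounds the
  -- degree of vertex `zero` from above.
  v≤min⁺ (≤-trans (3≤degree zero) (degree≤n G zero)) (map⁺ (universal 3≤degree (allFin _)))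
  where
  3≤degree : ∀ x → 3 ≤ Graph.degree G x
  3≤degree = critical⇒3≤degree G crit
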